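{- For every integer $m\ge2$ and all nonnegative integers $k_1,\dots,k_{m-1}$, $d^{(m)}_{k_1,\dots,k_{m-1}}$ is a positive integer divisible by $m$.
   Context: For $1\le j\le m$ and integers $k_1,\dots,k_{m-1}\ge0$, $e^{(m),j}_{k_1,\dots,k_{m-1}}=\prod_{1\le i\le m,\,i\ne j}(i-j)^{k_{(i-j)\bmod m}}$, where $(i-j)\bmod m$ denotes the representative in $\{1,\dots,m-1\}$. Then $d^{(m)}_{k_1,\dots,k_{m-1}}=2\sum_{j=1}^{p}e^{(m),j}_{k_1,\dots,k_{m-1}}$ if $m=2p$, and $d^{(m)}_{k_1,\dots,k_{m-1}}=e^{(m),p+1}_{k_1,\dots,k_{m-1}}+2\sum_{j=1}^{p}e^{(m),j}_{k_1,\dots,k_{m-1}}$ if $m=2p+1$. -}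

module Defs where

open import Algebra.Properties.CommutativeMonoid.Sum as Sum using ()
open import Data.Fin.Base using (Fin; zero; toℕ; fromℕ; fromℕ<; inject₁; punchOut; _↑ˡ_)
open import Data.Fin.Properties using (toℕ<n; toℕ-injective; toℕ-fromℕ<) renaming (_≟_ to _≟ᶠ_)
open import Data.Integer.Base using (ℤ; +_; 1ℤ; ∣_∣; _+_; _-_; _*_; _^_)
open import Data.Integer.DivMod using (_%ℕ_; _/ℕ_; n%ℕd<d; a≡a%ℕn+[a/ℕn]*n)
open import Data.Integer.Properties using (+-0-commutativeMonoid; *-1-commutativeMonoid; +-identityˡ; +-injective; abs-*; ∣i∣≡0⇒i≡0; i-j≡0⇒i≡j; m-n≡m⊖n; ∣m⊝n∣≤m⊔n)
open import Data.Nat.Base as ℕ using (ℕ; zero; suc)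
import Data.Nat.Properties as ℕ
open import Data.Nat.Divisibility using (divides; >⇒∤)
open import Relation.Binary.PropositionalEquality using (_≡_; _≢_; refl; sym; trans; cong; subst)
open import Relation.Nullary.Decidable.Core using (Dec; yes; no)
open import Relation.Nullary.Negation.Core using (contradiction)

open Sum +-0-commutativeMonoid public using () renaming (sum to ∑)
open Sum *-1-commutativeMonoid public using () renaming (sum to ∏)

-- The indices i, j ∈ {1,…,m} are represented by Fin m, so position 0 stands
-- for 1; the shift does not affect i - j.
diff : ∀ {m} → Fin m → Fin m → ℤ
diff i j = + toℕ i - + toℕ j

∣diff∣<m : ∀ {m} (i j : Fin m) → ∣ diff i j ∣ ℕ.< m
∣diff∣<m i j = ℕ.≤-<-trans
  (subst (ℕ._≤ toℕ i ℕ.⊔ toℕ j) (cong ∣_∣ (sym (m-n≡m⊖n (toℕ i) (toℕ j)))) (∣m⊝n∣≤m⊔n (toℕ i) (toℕ j)))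
  (ℕ.⊔-lub (toℕ<n i) (toℕ<n j))

diff%m≡0⇒i≡j : ∀ {n} (i j : Fin (suc n)) → diff i j %ℕ suc n ≡ 0 → i ≡ j
diff%m≡0⇒i≡j {n} i j r≡0 =
  toℕ-injective (+-injective (i-j≡0⇒i≡j _ _ (∣i∣≡0⇒i≡0 (vanishes ∣ diff i j ∣ refl))))
  where
  q : ℤ
  q = diff i j /ℕ suc n

  diff≡q*m : diff i j ≡ q * + suc n
  diff≡q*m = trans (a≡a%ℕn+[a/ℕn]*n (diff i j) (suc n))
    (trans (cong (λ r → + r + q * + suc n) r≡0) (+-identityˡ _))

  vanishes : ∀ a → a ≡ ∣ diff i j ∣ → a ≡ 0
  vanishes zero    _  = refl
  vanishes (suc a) eq = contradiction
    (divides ∣ q ∣ (trans eq (trans (cong ∣_∣ diff≡q*m) (abs-* q (+ suc n)))))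
    (>⇒∤ (subst (ℕ._< suc n) (sym eq) (∣diff∣<m i j)))

residue : ∀ {n} → Fin (suc n) → Fin (suc n) → Fin (suc n)
residue {n} i j = fromℕ< (n%ℕd<d (diff i j) (suc n))

residue≢0 : ∀ {n} (i j : Fin (suc n)) → i ≢ j → zero ≢ residue i j
residue≢0 {n} i j i≢j 0≡r =
  i≢j (diff%m≡0⇒i≡j i j (sym (trans (cong toℕ 0≡r) (toℕ-fromℕ< (n%ℕd<d (diff i j) (suc n))))))

-- A family k₁,…,k_{m-1} is a function k : Fin (m ∸ 1) → ℕ with k_r stored at
-- position r - 1.  For i ≢ j this is the position of k_{(i-j) mod m}.
position : ∀ {m} (i j : Fin m) → i ≢ j → Fin (m ℕ.∸ 1)
position {suc n} i j i≢j = punchOut (residue≢0 i j i≢j)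

factor : ∀ {m} → (Fin (m ℕ.∸ 1) → ℕ) → (i j : Fin m) → Dec (i ≡ j) → ℤ
factor k i j (yes _)  = 1ℤ
factor k i j (no i≢j) = diff i j ^ k (position i j i≢j)

e : (m : ℕ) → (Fin (m ℕ.∸ 1) → ℕ) → Fin m → ℤ
e m k j = ∏ {m} (λ i → factor k i j (i ≟ᶠ j))

data Halving : ℕ → Set where
  even : ∀ p → Halving (2 ℕ.* p)
  odd  : ∀ p → Halving (suc (2 ℕ.* p))

halving : ∀ m → Halving m
halving zero = even 0
halving (suc m) with halving m
... | even p = odd p
... | odd p  = subst Halving (ℕ.*-suc 2 p) (even (suc p))

-- 2 * p unfolds to p + (p + 0).  The index j ∈ {1,…,p} is j : Fin p embedded
-- in Fin m with the same value, and p + 1 is the embedding of fromℕ p.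
dBy : ∀ {m} → Halving m → (Fin (m ℕ.∸ 1) → ℕ) → ℤ
dBy (even p) k = + 2 * ∑ {p} (λ j → e (2 ℕ.* p) k (j ↑ˡ (p ℕ.+ 0)))
dBy (odd p)  k = e (suc (2 ℕ.* p)) k (fromℕ p ↑ˡ (p ℕ.+ 0))
  + + 2 * ∑ {p} (λ j → e (suc (2 ℕ.* p)) k (inject₁ j ↑ˡ (p ℕ.+ 0)))

d : (m : ℕ) → (Fin (m ℕ.∸ 1) → ℕ) → ℤ
d m = dBy (halving m)

{-# OPTIONS --safe #-}

-- Write E j for e^{(m),j+1} and S j = E 0 + ⋯ + E (j-1).  Matching the factor at
-- i of E j with the factor at i+1 of E (j+1) leaves one factor of each unmatched,
-- so that E j = A (m-j-1)^κ and E (j+1) = A (-(j+1))^κ for some A and κ.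
-- Hence E j ≡ E (j+1) mod m, and m ∣ S j - j E j by induction on j; as d is
-- 2 S p or 2 S p + E p, it is congruent to m E p mod m.
-- For positivity, either E (j+1) = E j or (m-j-1) |E (j+1)| ≤ (j+1) |E j|, and
-- from this j E j ≤ S j and -(m-j) E j ≤ S j follow by induction for j ≤ m/2.
-- At j = p they give p |E p| ≤ S p, where E p ≠ 0.
module Submission where

open import Defs
open import Data.Fin.Base using (Fin; zero; suc; toℕ; fromℕ; fromℕ<; inject₁; punchOut; _↑ˡ_)
open import Data.Fin.Properties using (toℕ-fromℕ; toℕ-inject₁; toℕ-↑ˡ; fromℕ<-cong)
  renaming (_≟_ to _≟ᶠ_)
open import Data.Integer.Base using (ℤ; +_; -[1+_]; 0ℤ; 1ℤ; ∣_∣; -_; _+_; _-_; _*_; _^_; _⊖_; _<_; _≤_; +<+; +≤+; -≤+)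
open import Data.Integer.DivMod using (_%ℕ_; n%ℕd<d)
open import Data.Integer.Divisibility.Signed using (_∣_; divides; ∣m∣n⇒∣m+n; ∣m∣n⇒∣m-n; ∣n⇒∣m*n; ∣m⇒∣m*n; ∣-refl; ∣-trans)
open import Data.Integer.Properties
open import Data.Integer.Tactic.RingSolver using (solve-∀)
open import Data.Nat.Base as ℕ using (ℕ; zero; suc; _∸_; z≤n; s≤s)
open import Data.Nat.DivMod using (m<n⇒m%n≡m)
import Data.Nat.Properties as ℕ
import Data.Nat.Tactic.RingSolver as ℕ-Solver
open import Data.Product.Base using (∃₂; _×_; _,_)
open import Data.Sum.Base using (_⊎_; inj₁; inj₂; [_,_]′)
open import Data.Vec.Functional using (Vector; _∷_)
open import Function.Base using (_∘_)
open import Relation.Binary.PropositionalEquality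
open import Relation.Nullary.Decidable.Core using (yes; no)
open import Relation.Nullary.Negation.Core using (contradiction)

import Algebra.Properties.Monoid.Sum +-0-monoid as Sum
import Algebra.Properties.Monoid.Sum *-1-monoid as Product

-- Powers, products and sums of integers

i≤+∣i∣ : ∀ i → i ≤ + ∣ i ∣
i≤+∣i∣ (+ _)    = ≤-refl
i≤+∣i∣ -[1+ _ ] = -≤+

-i≤+∣i∣ : ∀ i → - i ≤ + ∣ i ∣
-i≤+∣i∣ i = subst (λ x → - i ≤ + x) (∣-i∣≡∣i∣ i) (i≤+∣i∣ (- i))

∣i^n∣≡∣i∣^n : ∀ i n → ∣ i ^ n ∣ ≡ ∣ i ∣ ℕ.^ n
∣i^n∣≡∣i∣^n i zero    = refl
∣i^n∣≡∣i∣^n i (suc n) = trans (abs-* i (i ^ n)) (cong (∣ i ∣ ℕ.*_) (∣i^n∣≡∣i∣^n i n))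

0≤i∧0≤j⇒0≤i*j : ∀ {i j} → 0ℤ ≤ i → 0ℤ ≤ j → 0ℤ ≤ i * j
0≤i∧0≤j⇒0≤i*j {+ m} {+ n} _ _ = subst (0ℤ ≤_) (pos-* m n) (+≤+ z≤n)

0≤i⇒0≤i^n : ∀ {i} n → 0ℤ ≤ i → 0ℤ ≤ i ^ n
0≤i⇒0≤i^n zero    0≤i = +≤+ z≤n
0≤i⇒0≤i^n (suc n) 0≤i = 0≤i∧0≤j⇒0≤i*j 0≤i (0≤i⇒0≤i^n n 0≤i)

i-j∣i^n-j^n : ∀ i j n → i - j ∣ i ^ n - j ^ n
i-j∣i^n-j^n i j zero    = divides 0ℤ refl
i-j∣i^n-j^n i j (suc n) = subst (i - j ∣_) (split i j (i ^ n) (j ^ n))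
  (∣m∣n⇒∣m+n (∣n⇒∣m*n i (i-j∣i^n-j^n i j n)) (∣m⇒∣m*n (j ^ n) ∣-refl))
  where
  split : ∀ i j x y → i * (x - y) + (i - j) * y ≡ i * x - j * y
  split = solve-∀

∏-closed : ∀ {ℓ} (P : ℤ → Set ℓ) → P 1ℤ → (∀ {x y} → P x → P y → P (x * y)) →
           ∀ {n} (f : Vector ℤ n) → (∀ i → P (f i)) → P (∏ f)
∏-closed P p1 p* {zero}  f pf = p1
∏-closed P p1 p* {suc n} f pf = p* (pf zero) (∏-closed P p1 p* (f ∘ suc) (pf ∘ suc))

∑-toℕ-suc : ∀ (f : ℕ → ℤ) n → ∑ {suc n} (f ∘ toℕ) ≡ ∑ {n} (f ∘ toℕ) + f n
∑-toℕ-suc f n = trans (Sum.sum-init-last {n} (f ∘ toℕ))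
  (cong₂ _+_ (Sum.sum-cong-≗ {n} (cong f ∘ toℕ-inject₁)) (cong f (toℕ-fromℕ n)))

-- Linear bounds on partial sums

-- Applied with `s` = S j, `e` = E j and the weights j and m - j, whose sum stays m as j grows.
-- Being linear in `e`, both inequalities survive adding `e` to `s`.
Bound : ℕ → ℕ → ℤ → ℤ → Set
Bound a b s e = (+ a * e ≤ s) × (- (+ b * e) ≤ s)

bound-∣∣ : ∀ {a b s e} → a ℕ.≤ b → Bound a b s e → + (a ℕ.* ∣ e ∣) ≤ s
bound-∣∣ {a} {e = + x} _ (ae≤s , _) = subst (_≤ _) (sym (pos-* a x)) ae≤s
bound-∣∣ {a} {b} {e = e@(-[1+ x ])} a≤b (_ , -be≤s) = ≤-trans
  (+≤+ (ℕ.*-monoˡ-≤ ∣ e ∣ a≤b))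
  (subst (_≤ _) (trans (neg-distribʳ-* (+ b) e) (sym (pos-* b (suc x)))) -be≤s)

∣∣-bound : ∀ {a b s e} → a ℕ.≤ b → + (b ℕ.* ∣ e ∣) ≤ s → Bound a b s e
∣∣-bound {a} {b} {s} {e} a≤b be≤s =
  ≤-trans (i≤+∣i∣ (+ a * e)) (≤-trans (+≤+ ∣ae∣≤b∣e∣) be≤s) ,
  ≤-trans (-i≤+∣i∣ (+ b * e)) (subst (λ x → + x ≤ s) (sym (abs-* (+ b) e)) be≤s)
  where
  ∣ae∣≤b∣e∣ : ∣ + a * e ∣ ℕ.≤ b ℕ.* ∣ e ∣
  ∣ae∣≤b∣e∣ = subst (ℕ._≤ b ℕ.* ∣ e ∣) (sym (abs-* (+ a) e)) (ℕ.*-monoˡ-≤ ∣ e ∣ a≤b)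

bound-shift : ∀ {a b s e} → Bound a (suc b) s e → Bound (suc a) b (s + e) e
bound-shift {a} {b} {s} {e} (ae≤s , -be≤s) =
  subst (_≤ s + e) (lower (+ a) e) (+-monoˡ-≤ e ae≤s) ,
  subst (_≤ s + e) (upper (+ b) e) (+-monoˡ-≤ e -be≤s)
  where
  lower : ∀ a e → a * e + e ≡ (1ℤ + a) * e
  lower = solve-∀
  upper : ∀ b e → - ((1ℤ + b) * e) + e ≡ - (b * e)
  upper = solve-∀

-- Adding `e` to `s` moves one unit of weight from the second inequality to the first, which settles
-- `e′ ≡ e`. Otherwise b|e′| ≤ (a+1)|e| ≤ s + e, and this returns both inequalities because a + 1 ≤
-- b.
bound-step : ∀ {a b s e e′} → suc a ℕ.≤ b →
             e′ ≡ e ⊎ b ℕ.* ∣ e′ ∣ ℕ.≤ suc a ℕ.* ∣ e ∣ →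
             Bound a (suc b) s e → Bound (suc a) b (s + e) e′
bound-step {a} {b} a<b (inj₁ refl)   bd = bound-shift {a} {b} bd
bound-step {a} {b} a<b (inj₂ be′≤ae) bd =
  ∣∣-bound a<b (≤-trans (+≤+ be′≤ae) (bound-∣∣ a<b (bound-shift {a} {b} bd)))

-- For `κ` = 0 both powers are 1. Otherwise one factor `a` and one factor `b` cancel, leaving the
-- monotonicity of powers.
power-ratio : ∀ {a b} x κ → a ℕ.≤ b →
              x * (- + a) ^ κ ≡ x * (+ b) ^ κ ⊎
              b ℕ.* ∣ x * (- + a) ^ κ ∣ ℕ.≤ a ℕ.* ∣ x * (+ b) ^ κ ∣
power-ratio         x zero    a≤b = inj₁ refl
power-ratio {a} {b} x (suc κ) a≤b = inj₂ (begin
  b ℕ.* ∣ x * (- + a) ^ suc κ ∣         ≡⟨ cong (b ℕ.*_) (trans (abs-power (- + a)) (cong (λ y → ∣ x ∣ ℕ.* y ℕ.^ suc κ) (∣-i∣≡∣i∣ (+ a)))) ⟩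
  b ℕ.* (∣ x ∣ ℕ.* (a ℕ.* a ℕ.^ κ))     ≡⟨ exchange b ∣ x ∣ a (a ℕ.^ κ) ⟩
  a ℕ.* (∣ x ∣ ℕ.* (b ℕ.* a ℕ.^ κ))     ≤⟨ ℕ.*-monoʳ-≤ a (ℕ.*-monoʳ-≤ ∣ x ∣ (ℕ.*-monoʳ-≤ b (ℕ.^-monoˡ-≤ κ a≤b))) ⟩
  a ℕ.* (∣ x ∣ ℕ.* (b ℕ.* b ℕ.^ κ))     ≡⟨ cong (a ℕ.*_) (abs-power (+ b)) ⟨
  a ℕ.* ∣ x * (+ b) ^ suc κ ∣           ∎)
  where
  open ℕ.≤-Reasoning
  abs-power : ∀ y → ∣ x * y ^ suc κ ∣ ≡ ∣ x ∣ ℕ.* ∣ y ∣ ℕ.^ suc κ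
  abs-power y = trans (abs-* x (y ^ suc κ)) (cong (∣ x ∣ ℕ.*_) (∣i^n∣≡∣i∣^n y (suc κ)))
  exchange : ∀ b x a c → b ℕ.* (x ℕ.* (a ℕ.* c)) ≡ a ℕ.* (x ℕ.* (b ℕ.* c))
  exchange = ℕ-Solver.solve-∀

-- The products E j for m = n + 1

module _ {n : ℕ} (k : Fin n → ℕ) where

  -- The convention k₀ = 0 makes the factor at i = j equal to 0 ^ 0 = 1.
  exponent : ℤ → ℕ
  exponent z = (0 ∷ k) (fromℕ< (n%ℕd<d z (suc n)))

  -- With j in ℕ and factors depending only on the difference, i and j can be shifted together.
  E : ℕ → ℤ
  E j = ∏ {suc n} λ i → (toℕ i ⊖ j) ^ exponent (toℕ i ⊖ j)

  S : ℕ → ℤ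
  S j = ∑ {j} (E ∘ toℕ)

  punchOut-∷ : (r : Fin (suc n)) (0≢r : zero ≢ r) → k (punchOut 0≢r) ≡ (0 ∷ k) r
  punchOut-∷ zero    0≢0 = contradiction refl 0≢0
  punchOut-∷ (suc r) _   = refl

  factor≡ : ∀ i j → factor k i j (i ≟ᶠ j) ≡ (toℕ i ⊖ toℕ j) ^ exponent (toℕ i ⊖ toℕ j)
  factor≡ i j with i ≟ᶠ j
  ... | yes refl rewrite n⊖n≡0 (toℕ i) = refl
  ... | no i≢j = trans (cong (diff i j ^_) (punchOut-∷ (residue i j) (residue≢0 i j i≢j)))
    (cong (λ z → z ^ exponent z) (m-n≡m⊖n (toℕ i) (toℕ j)))

  e≡E : ∀ j {x} → toℕ j ≡ x → e (suc n) k j ≡ E x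
  e≡E j refl = Product.sum-cong-≗ {suc n} (λ i → factor≡ i j)

  -- As m = (j+1) + (b+1), the residue of -(j+1) is b+1, so the two unmatched factors carry the same
  -- exponent.
  exponent-wrap : ∀ {j b} → n ≡ j ℕ.+ suc b → exponent (0 ⊖ suc j) ≡ exponent (+ suc b)
  exponent-wrap {j} {b} refl = cong (0 ∷ k) (fromℕ<-cong _ _ residues≡ _ _)
    where
    residues≡ : -[1+ j ] %ℕ suc n ≡ suc b ℕ.% suc n
    residues≡ rewrite m<n⇒m%n≡m (s≤s (ℕ.m<m+n j (ℕ.z<s {b})))
                    | m<n⇒m%n≡m (s≤s (ℕ.m≤n+m (suc b) j)) = ℕ.m+n∸m≡n j (suc b)

  E-consecutive : ∀ {j b} → n ≡ j ℕ.+ suc b →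
                  ∃₂ λ x κ → E j ≡ x * (+ suc b) ^ κ × E (suc j) ≡ x * (- + suc j) ^ κ
  E-consecutive {j} {b} n≡j+1+b = x , exponent (+ suc b) ,
    -- `E j` gives up its last factor, at i = n, where the difference is n - j = b + 1.
    trans (Product.sum-init-last {n} (λ i → F (toℕ i ⊖ j)))
      (cong₂ _*_ (Product.sum-cong-≗ {n} (λ i → cong (λ y → F (y ⊖ j)) (toℕ-inject₁ i)))
                 (cong F last-diff)) ,
    -- `E (suc j)` gives up its first factor, at i = 0.
    trans (*-comm (F (0 ⊖ suc j)) x′)
      (cong₂ _*_ (Product.sum-cong-≗ {n} (λ i → cong F ([1+m]⊖[1+n]≡m⊖n (toℕ i) j)))
                 (cong (-[1+ j ] ^_) (exponent-wrap n≡j+1+b)))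
    where
    F : ℤ → ℤ
    F z = z ^ exponent z
    x x′ : ℤ
    x  = ∏ {n} λ i → F (toℕ i ⊖ j)
    x′ = ∏ {n} λ i → F (suc (toℕ i) ⊖ suc j)
    last-diff : toℕ (fromℕ n) ⊖ j ≡ + suc b
    last-diff = trans (cong (_⊖ j) (trans (toℕ-fromℕ n) n≡j+1+b))
      (trans (⊖-≥ (ℕ.m≤m+n j (suc b))) (cong +_ (ℕ.m+n∸m≡n j (suc b))))

  E-nonZero : ∀ j → E j ≢ 0ℤ
  E-nonZero j = ∏-closed (_≢ 0ℤ) (λ ())
    (λ {x} x≢0 y≢0 → [ x≢0 , y≢0 ]′ ∘ i*j≡0⇒i≡0∨j≡0 x) {suc n}
    (λ i → (toℕ i ⊖ j) ^ exponent (toℕ i ⊖ j)) (λ i → factor≢0 (toℕ i ⊖ j))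
    where
    factor≢0 : ∀ z → z ^ exponent z ≢ 0ℤ
    -- The exponent computes to 0 here, so the factor is 0 ^ 0 = 1.
    factor≢0 (+ zero)     = λ ()
    factor≢0 z@(+ suc _)  eq with () ← i^n≡0⇒i≡0 z (exponent z) eq
    factor≢0 z@(-[1+ _ ]) eq with () ← i^n≡0⇒i≡0 z (exponent z) eq

  E₀-nonNeg : 0ℤ ≤ E 0
  E₀-nonNeg = ∏-closed (0ℤ ≤_) (+≤+ z≤n) 0≤i∧0≤j⇒0≤i*j {suc n}
    (λ i → (toℕ i ⊖ 0) ^ exponent (toℕ i ⊖ 0)) (λ i → 0≤i⇒0≤i^n (exponent (toℕ i ⊖ 0)) (+≤+ z≤n))

  -- Since `suc b` is m - j, the last hypothesis says 2j ≤ m. In the step to j + 1 it orders the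
  -- bases of the unmatched factors as `power-ratio` requires.
  S-bound : ∀ j b → n ≡ j ℕ.+ b → j ℕ.≤ suc b → Bound j (suc b) (S j) (E j)
  S-bound zero b _ _ = ≤-refl , neg-mono-≤ (0≤i∧0≤j⇒0≤i*j (+≤+ (z≤n {suc b})) E₀-nonNeg)
  S-bound (suc j) b n≡1+j+b (s≤s j≤b) with n≡j+1+b ← trans n≡1+j+b (sym (ℕ.+-suc j b))
    with x , κ , Ej , E1+j ← E-consecutive n≡j+1+b =
    subst (λ s → Bound (suc j) (suc b) s (E (suc j))) (sym (∑-toℕ-suc E j))
      (bound-step (s≤s j≤b) ratio (S-bound j (suc b) n≡j+1+b (ℕ.m≤n⇒m≤1+n (ℕ.m≤n⇒m≤1+n j≤b))))
    where
    ratio : E (suc j) ≡ E j ⊎ suc b ℕ.* ∣ E (suc j) ∣ ℕ.≤ suc j ℕ.* ∣ E j ∣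
    ratio = subst₂ (λ u v → v ≡ u ⊎ suc b ℕ.* ∣ v ∣ ℕ.≤ suc j ℕ.* ∣ u ∣) (sym Ej) (sym E1+j)
      (power-ratio x κ (s≤s j≤b))

  m∣E-E : ∀ {j b} → n ≡ j ℕ.+ suc b → + suc n ∣ E (suc j) - E j
  m∣E-E {j} {b} n≡j+1+b with x , κ , Ej , E1+j ← E-consecutive n≡j+1+b =
    subst (+ suc n ∣_) (trans (distrib x _ _) (sym (cong₂ _-_ E1+j Ej)))
      -- The bases -(j+1) and b+1 differ by -m, so their powers agree modulo m.
      (∣n⇒∣m*n x (∣-trans (divides (- 1ℤ) m≡) (i-j∣i^n-j^n (- + suc j) (+ suc b) κ)))
    where
    distrib : ∀ x y z → x * (y - z) ≡ x * y - x * z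
    distrib = solve-∀
    negate : ∀ u v → - u - v ≡ - 1ℤ * (u + v)
    negate = solve-∀
    m≡ : - + suc j - + suc b ≡ - 1ℤ * + suc n
    m≡ = trans (negate (+ suc j) (+ suc b)) (cong (λ y → - 1ℤ * + suc y) (sym n≡j+1+b))

  m∣S-jE : ∀ j b → n ≡ j ℕ.+ b → + suc n ∣ S j - + j * E j
  m∣S-jE zero    b _ = divides 0ℤ refl
  m∣S-jE (suc j) b n≡1+j+b with n≡j+1+b ← trans n≡1+j+b (sym (ℕ.+-suc j b)) =
    -- S j - j E j changes by -(j+1)(E (j+1) - E j), a multiple of m.
    subst (+ suc n ∣_)
      (trans (telescope (S j) (+ j) (E j) (E (suc j)))
             (cong (_- + suc j * E (suc j)) (sym (∑-toℕ-suc E j))))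
      (∣m∣n⇒∣m-n (m∣S-jE j (suc b) n≡j+1+b) (∣n⇒∣m*n (+ suc j) (m∣E-E n≡j+1+b)))
    where
    telescope : ∀ s a u v → s - a * u - (1ℤ + a) * (v - u) ≡ s + u - (1ℤ + a) * v
    telescope = solve-∀

  ∣E∣≤S : ∀ p b → n ≡ suc p ℕ.+ b → p ℕ.≤ b → + ∣ E (suc p) ∣ ≤ S (suc p)
  ∣E∣≤S p b n≡1+p+b p≤b = ≤-trans (+≤+ (ℕ.m≤m+n ∣ E (suc p) ∣ (p ℕ.* ∣ E (suc p) ∣)))
    (bound-∣∣ (s≤s p≤b) (S-bound (suc p) b n≡1+p+b (s≤s p≤b)))

  0<S : ∀ p b → n ≡ suc p ℕ.+ b → p ℕ.≤ b → 0ℤ < S (suc p)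
  0<S p b n≡1+p+b p≤b = <-≤-trans
    (+<+ (ℕ.n≢0⇒n>0 (E-nonZero (suc p) ∘ ∣i∣≡0⇒i≡0))) (∣E∣≤S p b n≡1+p+b p≤b)

  -- For odd m, where the middle term may be negative.
  0≤S+E : ∀ p b → n ≡ suc p ℕ.+ b → p ℕ.≤ b → 0ℤ ≤ S (suc p) + E (suc p)
  0≤S+E p b n≡1+p+b p≤b = subst (_≤ S (suc p) + E (suc p)) (+-inverseˡ (E (suc p)))
    (+-monoˡ-≤ (E (suc p)) (≤-trans (-i≤+∣i∣ (E (suc p))) (∣E∣≤S p b n≡1+p+b p≤b)))

-- Even and odd m

double : ∀ s → s + s ≡ + 2 * s
double = solve-∀

dBy-positive-divisible : ∀ {m} (h : Halving m) → 2 ℕ.≤ m → (k : Fin (m ∸ 1) → ℕ) →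
                         (0ℤ < dBy h k) × (+ m ∣ dBy h k)
dBy-positive-divisible (odd zero) (s≤s ())
dBy-positive-divisible (even (suc p)) _ k =
  subst (λ s → (0ℤ < + 2 * s) × (+ m ∣ + 2 * s)) (sym S≡)
    ( subst (0ℤ <_) (double (S k (suc p))) (+-mono-< 0<s 0<s)
    -- With q = p + 1 and m = 2q, 2(S q - q E q) + m E q = 2 S q.
    , subst (+ m ∣_) regroup (∣m∣n⇒∣m+n (∣n⇒∣m*n (+ 2) (m∣S-jE k (suc p) p n≡))
                                        (∣m⇒∣m*n (E k (suc p)) ∣-refl)))
  where
  m : ℕ
  m = 2 ℕ.* suc p
  n≡ : p ℕ.+ (suc p ℕ.+ 0) ≡ suc p ℕ.+ p
  n≡ = trans (ℕ.+-suc p (p ℕ.+ 0)) (cong (λ x → suc (p ℕ.+ x)) (ℕ.+-identityʳ p))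
  0<s : 0ℤ < S k (suc p)
  0<s = 0<S k p p n≡ ℕ.≤-refl
  S≡ : ∑ {suc p} (λ j → e m k (j ↑ˡ (suc p ℕ.+ 0))) ≡ S k (suc p)
  S≡ = Sum.sum-cong-≗ {suc p} (λ j → e≡E k (j ↑ˡ (suc p ℕ.+ 0)) (toℕ-↑ˡ j _))
  identity : ∀ s a u → + 2 * (s - a * u) + + 2 * a * u ≡ + 2 * s
  identity = solve-∀
  regroup : + 2 * (S k (suc p) - + suc p * E k (suc p)) + + m * E k (suc p) ≡ + 2 * S k (suc p)
  regroup = trans
    (cong (λ x → + 2 * (S k (suc p) - + suc p * E k (suc p)) + x * E k (suc p)) (pos-* 2 (suc p)))
    (identity (S k (suc p)) (+ suc p) (E k (suc p)))
dBy-positive-divisible (odd (suc p)) _ k =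
  subst₂ (λ u s → (0ℤ < u + + 2 * s) × (+ m ∣ u + + 2 * s)) (sym E≡) (sym S≡)
    ( subst (0ℤ <_) (rearrange (S k (suc p)) (E k (suc p)))
        (+-mono-≤-< (0≤S+E k p (suc p) n≡ (ℕ.n≤1+n p)) (0<S k p (suc p) n≡ (ℕ.n≤1+n p)))
    -- Now m = 2q + 1 leaves one further E q, which is the middle term because E counts from 0.
    , subst (+ m ∣_) regroup (∣m∣n⇒∣m+n (∣n⇒∣m*n (+ 2) (m∣S-jE k (suc p) (suc p) n≡))
                                        (∣m⇒∣m*n (E k (suc p)) ∣-refl)))
  where
  m : ℕ
  m = suc (2 ℕ.* suc p)
  n≡ : 2 ℕ.* suc p ≡ suc p ℕ.+ suc p
  n≡ = cong (suc p ℕ.+_) (ℕ.+-identityʳ (suc p))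
  E≡ : e m k (fromℕ (suc p) ↑ˡ (suc p ℕ.+ 0)) ≡ E k (suc p)
  E≡ = e≡E k (fromℕ (suc p) ↑ˡ (suc p ℕ.+ 0)) (trans (toℕ-↑ˡ (fromℕ (suc p)) _) (toℕ-fromℕ (suc p)))
  S≡ : ∑ {suc p} (λ j → e m k (inject₁ j ↑ˡ (suc p ℕ.+ 0))) ≡ S k (suc p)
  S≡ = Sum.sum-cong-≗ {suc p}
    (λ j → e≡E k (inject₁ j ↑ˡ (suc p ℕ.+ 0)) (trans (toℕ-↑ˡ (inject₁ j) _) (toℕ-inject₁ j)))
  rearrange : ∀ s u → s + u + s ≡ u + + 2 * s
  rearrange = solve-∀
  identity : ∀ s a u → + 2 * (s - a * u) + (1ℤ + + 2 * a) * u ≡ u + + 2 * s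
  identity = solve-∀
  regroup : + 2 * (S k (suc p) - + suc p * E k (suc p)) + + m * E k (suc p)
            ≡ E k (suc p) + + 2 * S k (suc p)
  regroup = trans
    (cong (λ x → + 2 * (S k (suc p) - + suc p * E k (suc p)) + (1ℤ + x) * E k (suc p)) (pos-* 2 (suc p)))
    (identity (S k (suc p)) (+ suc p) (E k (suc p)))

mainTheorem15 : (m : ℕ) → 2 ℕ.≤ m → (k : Fin (m ∸ 1) → ℕ) → (0ℤ < d m k) × (+ m ∣ d m k)
mainTheorem15 m = dBy-positive-divisible (halving m)
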